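{- For every topological tree $S$ with at least two leaves, $$J(S) \geq \frac{(|S|-1)!}{|S|^{|S|-1}-1}.$$
   Context: A topological tree is a finite rooted tree in which every non-leaf vertex has outdegree (number of children) at least $2$; the single-vertex tree is allowed, its vertex being both root and leaf. Trees are considered up to isomorphism of rooted trees (unordered, unlabelled). $|T|$ denotes the number of leaves of $T$. A nonempty set $L$ of leaves of $T$ induces a topological tree: take the smallest subtree of $T$ connecting the leaves in $L$, rooted at the most recent common ancestor of $L$, and suppress (erase, joining the neighbours) all vertices of outdegree $1$. For topological trees $S,T$, $c(S,T)$ is the number of subsets of the leaf set of $T$ whose induced tree is isomorphic, as a rooted tree, to $S$, and $\gamma(S,T)=c(S,T)/\binom{|T|}{|S|}$ (for $|T|\ge |S|$). The inducibility of $S$ is $$J(S)=\limsup_{n\to\infty}\ \max_{\substack{|T|=n\\ T\text{ topological tree}}}\gamma(S,T).$$ -}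

module Defs where

open import Data.Empty using (⊥-elim)
open import Data.Fin.Subset using (Subset; inside; outside)
open import Data.Integer using (+_)
open import Data.List using (List; []; _∷_; _++_; length; map; filter; fromMaybe; cartesianProductWith)
open import Data.List.Membership.Propositional using (_∈_; find; lose)
open import Data.List.Membership.Propositional.Properties
  using (∈-∃++; ∈-map⁺; ∈-filter⁺; ∈-filter⁻; ∈-cartesianProductWith⁺)
import Data.List.Relation.Binary.Permutation.Homogeneous as Homogeneous
import Data.List.Relation.Binary.Permutation.Setoid as Permutation
import Data.List.Relation.Binary.Permutation.Setoid.Properties as PermutationProperties
open import Data.List.Relation.Binary.Pointwise using (Pointwise; []; _∷_)
open import Data.List.Relation.Unary.All using (All; []; _∷_)
open import Data.List.Relation.Unary.Any using (here; there; any?)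
import Data.Maybe as Maybe
open import Data.Maybe using (Maybe; just; nothing)
import Data.Maybe.Relation.Unary.Any as MaybeAny
open import Data.Nat as ℕ using (ℕ; zero; suc; _+_; _≤_; z≤n; s≤s)
open import Data.Nat.Combinatorics using (_C_)
import Data.Nat.Properties as ℕ
open import Data.Product using (∃-syntax; _×_; _,_)
open import Data.Rational as ℚ using (ℚ; 0ℚ)
import Data.Rational.Properties as ℚ
open import Relation.Binary.Bundles using (DecTotalOrder; Setoid)
open import Data.List.Extrema (DecTotalOrder.totalOrder ℚ.≤-decTotalOrder) using (max)
import Data.Vec as Vec
open import Data.Vec using (Vec; []; _∷_)
open import Level using (0ℓ)
open import Relation.Binary.PropositionalEquality using (_≡_; _≢_; refl)
open import Relation.Nullary using (Dec; yes; no)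
open import Relation.Nullary.Decidable using (map′; _×-dec_; ¬?)

-- Constructively the limsup of a sequence of rationals need not be a located
-- real.  It is always an extended lower real, i.e. an open lower set of
-- rationals (classically: an element of [-∞,∞]).
record LowerReal : Set₁ where
  field
    _<∙    : ℚ → Set
    closed : ∀ {p q} → p ℚ.≤ q → q <∙ → p <∙
    open′  : ∀ {p} → p <∙ → ∃[ q ] p ℚ.< q × q <∙

infix 4 _<ℝ_ _≤ℝ_

_<ℝ_ : ℚ → LowerReal → Set
q <ℝ x = LowerReal._<∙ x q

_≤ℝ_ : LowerReal → LowerReal → Set
x ≤ℝ y = ∀ q → q <ℝ x → q <ℝ y

ι : ℚ → LowerReal
ι r = record
  { _<∙    = ℚ._< r
  ; closed = ℚ.≤-<-trans
  ; open′  = ℚ.<-dense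
  }

sup : {I : Set} → (I → ℚ) → LowerReal
sup a = record
  { _<∙    = λ q → ∃[ i ] q ℚ.< a i
  ; closed = λ p≤q (i , q<a) → i , ℚ.≤-<-trans p≤q q<a
  ; open′  = λ (i , p<a) → let q , p<q , q<a = ℚ.<-dense p<a in q , p<q , i , q<a
  }

-- Being below every x i is not an open condition, so a uniform margin is
-- required.
inf : {I : Set} → (I → LowerReal) → LowerReal
inf x = record
  { _<∙    = λ q → ∃[ r ] q ℚ.< r × (∀ i → r <ℝ x i)
  ; closed = λ p≤q (r , q<r , r<x) → r , ℚ.≤-<-trans p≤q q<r , r<x
  ; open′  = λ (r , p<r , r<x) →
      let q , p<q , q<r = ℚ.<-dense p<r in q , p<q , r , q<r , r<x
  }

limsup : (ℕ → ℚ) → LowerReal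
limsup a = inf λ (N : ℕ) → sup {I = ∃[ n ] N ≤ n} λ (n , _) → a n

-- The order of the children is an artefact of the representation; it is
-- disregarded by _≅_ below.
data Tree : Set where
  node : List Tree → Tree

data Topological : Tree → Set where
  node : ∀ {ts} → length ts ≢ 1 → All Topological ts → Topological (node ts)

mutual
  ∣_∣ : Tree → ℕ
  ∣ node [] ∣       = 1
  ∣ node (t ∷ ts) ∣ = ∣ t ∷ ts ∣*

  ∣_∣* : List Tree → ℕ
  ∣ [] ∣*     = 0
  ∣ t ∷ ts ∣* = ∣ t ∣ + ∣ ts ∣*

infix 4 _≅_ _≅?_

data _≅_ : Tree → Tree → Set where
  node : ∀ {ts us} → Homogeneous.Permutation _≅_ ts us → node ts ≅ node us

-- The leaves of a tree are numbered from left to right.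

-- Keeps the vertices with a descendant in L, i.e. the union of the paths from
-- the root to the elements of L.
mutual
  prune : (T : Tree) → Subset ∣ T ∣ → Maybe Tree
  prune (node [])       (inside  ∷ []) = just (node [])
  prune (node [])       (outside ∷ []) = nothing
  prune (node (t ∷ ts)) L with prune* (t ∷ ts) L
  ... | []         = nothing
  ... | us@(_ ∷ _) = just (node us)

  prune* : (ts : List Tree) → Subset ∣ ts ∣* → List Tree
  prune* []       _ = []
  prune* (t ∷ ts) L =
    fromMaybe (prune t (Vec.take ∣ t ∣ L)) ++ prune* ts (Vec.drop ∣ t ∣ L)

-- The subtree rooted at the most recent common ancestor of all leaves.
atMRCA : Tree → Tree
atMRCA (node (t ∷ [])) = atMRCA t
atMRCA t               = t

mutual
  suppress : Tree → Tree
  suppress (node [])             = node []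
  suppress (node (t ∷ []))       = suppress t
  suppress (node (t ∷ u ∷ ts))   = node (suppress t ∷ suppress u ∷ suppress* ts)

  suppress* : List Tree → List Tree
  suppress* []       = []
  suppress* (t ∷ ts) = suppress t ∷ suppress* ts

-- nothing exactly when L is empty.
induced : (T : Tree) → Subset ∣ T ∣ → Maybe Tree
induced T L = Maybe.map (λ t → suppress (atMRCA t)) (prune T L)

≅-refl : ∀ {t} → t ≅ t
≅-refl {node ts} = node (Homogeneous.refl (go ts))
  where
  go : ∀ ts → Pointwise _≅_ ts ts
  go []       = []
  go (t ∷ ts) = ≅-refl ∷ go ts

mutual
  ≅-sym : ∀ {t u} → t ≅ u → u ≅ t
  ≅-sym (node p) = node (↭-sym p)

  ↭-sym : ∀ {ts us} → Homogeneous.Permutation _≅_ ts us → Homogeneous.Permutation _≅_ us ts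
  ↭-sym (Homogeneous.refl ps)    = Homogeneous.refl (≋-sym ps)
  ↭-sym (Homogeneous.prep e p)   = Homogeneous.prep (≅-sym e) (↭-sym p)
  ↭-sym (Homogeneous.swap e f p) = Homogeneous.swap (≅-sym f) (≅-sym e) (↭-sym p)
  ↭-sym (Homogeneous.trans p q)  = Homogeneous.trans (↭-sym q) (↭-sym p)

  ≋-sym : ∀ {ts us} → Pointwise _≅_ ts us → Pointwise _≅_ us ts
  ≋-sym []       = []
  ≋-sym (e ∷ es) = ≅-sym e ∷ ≋-sym es

≅-trans : ∀ {t u v} → t ≅ u → u ≅ v → t ≅ v
≅-trans (node p) (node q) = node (Homogeneous.trans p q)

≅-setoid : Setoid 0ℓ 0ℓ
≅-setoid = record
  { _≈_           = _≅_
  ; isEquivalence = record { refl = ≅-refl ; sym = ≅-sym ; trans = ≅-trans }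
  }

private
  open module ↭ = Permutation ≅-setoid using (_↭_)
  module ↭P     = PermutationProperties ≅-setoid

mutual
  _≅?_ : ∀ t u → Dec (t ≅ u)
  node ts ≅? node us = map′ node (λ { (node p) → p }) (ts ↭? us)

  _↭?_ : ∀ ts us → Dec (ts ↭ us)
  []       ↭? []       = yes ↭.↭-refl
  []       ↭? (u ∷ us) = no λ p → ℕ.0≢1+n (↭P.xs↭ys⇒|xs|≡|ys| p)
  (t ∷ ts) ↭? us with any? (t ≅?_) us
  ... | no ∄u = no λ p → ∄u (↭P.∈-resp-↭ p (here ≅-refl))
  ... | yes ∃u with find ∃u
  ...   | u , u∈us , t≅u with ∈-∃++ u∈us
  ...     | xs , ys , refl with ts ↭? (xs ++ ys)
  ...       | yes p = yes (↭.↭-trans (Homogeneous.prep t≅u p)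
                                     (↭.↭-sym (↭P.shift ≅-refl xs ys)))
  ...       | no ¬p = no λ p → ¬p (↭P.dropMiddleElement [] xs
                        (↭.↭-trans (Homogeneous.prep (≅-sym t≅u) ↭.↭-refl) p))

subsets : ∀ n → List (Subset n)
subsets zero    = [] ∷ []
subsets (suc n) = map (inside ∷_) (subsets n) ++ map (outside ∷_) (subsets n)

Induces : (S T : Tree) → Subset ∣ T ∣ → Set
Induces S T L = MaybeAny.Any (_≅ S) (induced T L)

induces? : ∀ S T L → Dec (Induces S T L)
induces? S T L = MaybeAny.dec (_≅? S) (induced T L)

c : Tree → Tree → ℕ
c S T = length (filter (induces? S T) (subsets ∣ T ∣))

-- Division by zero yields 0.
infixl 7 _÷_
_÷_ : ℕ → ℕ → ℚ
m ÷ zero  = 0ℚ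
m ÷ suc n = + m ℚ./ suc n

-- Of interest only for ∣ S ∣ ≤ ∣ T ∣; otherwise the binomial coefficient
-- vanishes and so does γ S T.
γ : Tree → Tree → ℚ
γ S T = c S T ÷ (∣ T ∣ C ∣ S ∣)

mutual
  topological? : ∀ t → Dec (Topological t)
  topological? (node ts) =
    map′ (λ (≢1 , ps) → node ≢1 ps) (λ { (node ≢1 ps) → ≢1 , ps })
         (¬? (length ts ℕ.≟ 1) ×-dec topological*? ts)

  topological*? : ∀ ts → Dec (All Topological ts)
  topological*? []       = yes []
  topological*? (t ∷ ts) =
    map′ (λ (p , ps) → p ∷ ps) (λ { (p ∷ ps) → p , ps })
         (topological? t ×-dec topological*? ts)

-- Lists of length at most w with entries from xs.
listsUpTo : {A : Set} → ℕ → List A → List (List A)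
listsUpTo zero    xs = [] ∷ []
listsUpTo (suc w) xs = [] ∷ cartesianProductWith _∷_ xs (listsUpTo w xs)

-- Trees with fewer than d edges on each path from the root, and with all
-- outdegrees at most w.
treesUpTo : ℕ → ℕ → List Tree
treesUpTo zero    w = []
treesUpTo (suc d) w = map node (listsUpTo w (treesUpTo d w))

-- In a topological tree with n leaves all outdegrees are at most n and every
-- path from the root has fewer than n edges; completeness is ∈-trees⁺.
trees : ℕ → List Tree
trees n = filter (λ t → topological? t ×-dec ∣ t ∣ ℕ.≟ n) (treesUpTo n n)

∈-trees⁻ : ∀ {n t} → t ∈ trees n → Topological t × ∣ t ∣ ≡ n
∈-trees⁻ {n} t∈ = let _ , p = ∈-filter⁻ _ {xs = treesUpTo n n} t∈ in p

mutual
  1≤∣_∣ : ∀ t → 1 ≤ ∣ t ∣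
  1≤∣ node [] ∣       = s≤s z≤n
  1≤∣ node (t ∷ ts) ∣ = ℕ.≤-trans 1≤∣ t ∣ (ℕ.m≤m+n ∣ t ∣ ∣ ts ∣*)

length≤∣_∣* : ∀ ts → length ts ≤ ∣ ts ∣*
length≤∣ [] ∣*     = z≤n
length≤∣ t ∷ ts ∣* = ℕ.+-mono-≤ 1≤∣ t ∣ length≤∣ ts ∣*

∈-listsUpTo : ∀ {A : Set} {w} {xs ys : List A} →
              length ys ≤ w → All (_∈ xs) ys → ys ∈ listsUpTo w xs
∈-listsUpTo {w = zero}  {ys = []} _ _ = here refl
∈-listsUpTo {w = suc w} {ys = []} _ _ = here refl
∈-listsUpTo {w = suc w} {ys = _ ∷ _} (s≤s l) (p ∷ ps) =
  there (∈-cartesianProductWith⁺ _∷_ p (∈-listsUpTo l ps))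

mutual
  ∈-treesUpTo : ∀ {d w t} → Topological t → ∣ t ∣ ≤ d → ∣ t ∣ ≤ w → t ∈ treesUpTo d w
  ∈-treesUpTo {zero}  {t = t} _ t≤d _ = ⊥-elim (ℕ.<⇒≱ 1≤∣ t ∣ t≤d)
  ∈-treesUpTo {suc d} {t = node []} _ _ _ = ∈-map⁺ node (∈-listsUpTo z≤n [])
  ∈-treesUpTo {suc d} {t = node (_ ∷ [])} (node ≢1 _) _ _ = ⊥-elim (≢1 refl)
  ∈-treesUpTo {suc d} {t = node (t ∷ u ∷ ts)} (node _ (p ∷ ps)) t≤d t≤w =
    ∈-map⁺ node (∈-listsUpTo (ℕ.≤-trans length≤∣ t ∷ u ∷ ts ∣* t≤w)
      ( ∈-treesUpTo p
          (ℕ.≤-pred (ℕ.≤-trans (ℕ.≤-reflexive (ℕ.+-comm 1 ∣ t ∣))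
            (ℕ.≤-trans (ℕ.+-monoʳ-≤ ∣ t ∣ 1≤us) t≤d)))
          (ℕ.≤-trans (ℕ.m≤m+n ∣ t ∣ ∣ u ∷ ts ∣*) t≤w)
      ∷ ∈-treesUpTo* ps
          (ℕ.≤-pred (ℕ.≤-trans (ℕ.+-monoˡ-≤ ∣ u ∷ ts ∣* 1≤∣ t ∣) t≤d))
          (ℕ.≤-trans (ℕ.m≤n+m ∣ u ∷ ts ∣* ∣ t ∣) t≤w)))
    where
    1≤us : 1 ≤ ∣ u ∷ ts ∣*
    1≤us = ℕ.≤-trans (s≤s z≤n) length≤∣ u ∷ ts ∣*

  ∈-treesUpTo* : ∀ {d w ts} → All Topological ts → ∣ ts ∣* ≤ d → ∣ ts ∣* ≤ w →
                 All (_∈ treesUpTo d w) ts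
  ∈-treesUpTo* [] _ _ = []
  ∈-treesUpTo* {ts = t ∷ ts} (p ∷ ps) ≤d ≤w =
      ∈-treesUpTo p (ℕ.≤-trans (ℕ.m≤m+n ∣ t ∣ _) ≤d) (ℕ.≤-trans (ℕ.m≤m+n ∣ t ∣ _) ≤w)
    ∷ ∈-treesUpTo* ps (ℕ.≤-trans (ℕ.m≤n+m _ ∣ t ∣) ≤d) (ℕ.≤-trans (ℕ.m≤n+m _ ∣ t ∣) ≤w)

∈-trees⁺ : ∀ {t} → Topological t → t ∈ trees ∣ t ∣
∈-trees⁺ p = ∈-filter⁺ _ (∈-treesUpTo p ℕ.≤-refl ℕ.≤-refl) (p , refl)

-- All densities are nonnegative, so the default value 0 matters only for the
-- empty maximum, n = 0.
maxγ : Tree → ℕ → ℚ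
maxγ S n = max 0ℚ (map (γ S) (trees n))

J : Tree → LowerReal
J S = limsup (maxγ S)

{-# OPTIONS --safe #-}

-- Let T₀ be the one-vertex tree, and let Tₕ₊₁ arise from S by replacing each
-- leaf with a copy of Tₕ.  Put k = |S| and n = |Tₕ| = kʰ.  A choice of one leaf in
-- each of the k copies of Tₕ induces S, and so does a choice within one copy
-- that already induced S; hence c(S, Tₕ₊₁) ≥ nᵏ + k c(S, Tₕ), which gives
-- nᵏ - n ≤ (kᵏ - k) c(S, Tₕ) for all h.  On the other side
-- k! C(n, k) ≤ n (n - 1)ᵏ⁻¹ ≤ nᵏ - n, so that γ(S, Tₕ) is at least the claimed
-- value for every h ≥ 1, without passing to a limit.
module Submission where

open import Defs
open import Data.Empty using (⊥; ⊥-elim)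
open import Data.Fin.Subset using (Subset; inside; outside)
import Data.Integer as ℤ
import Data.Integer.Properties as ℤ
open import Data.List using (List; []; _∷_; _++_; length; map; filter; fromMaybe)
open import Data.List.Membership.Propositional using (lose)
open import Data.List.Membership.Propositional.Properties using (∈-map⁺)
open import Data.List.Relation.Unary.All using (All; []; _∷_)
open import Data.Maybe as Maybe using (Maybe; just; nothing)
import Data.Maybe.Properties as Maybe
open import Data.Maybe.Relation.Unary.Any as MaybeAny using (just)
open import Data.Nat using (ℕ; zero; suc; _+_; _*_; _≤_; z≤n; s≤s; _∸_; _^_; _!;
  >-nonZero; ≢-nonZero⁻¹)
open import Data.Nat.Combinatorics using (_C_; nCk≡n!/k![n-k]!; k>n⇒nCk≡0; k![n∸k]!∣n!)
open import Data.Nat.DivMod using (m/n*n≡m)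
open import Data.Nat.Properties
open import Data.Nat.Tactic.RingSolver using (solve-∀)
open import Data.Product using (∃-syntax; _×_; _,_)
import Data.Rational as ℚ
import Data.Rational.Properties as ℚ
import Data.Rational.Unnormalised as ℚᵘ
import Data.Rational.Unnormalised.Properties as ℚᵘ
open import Data.Sum using (_⊎_; inj₁; inj₂; [_,_]′)
open import Data.Vec using ([]; _∷_; take; drop)
open import Function using (_∘_)
open import Relation.Binary.PropositionalEquality
  using (_≡_; _≢_; refl; sym; trans; cong; cong₂; subst; subst₂; module ≡-Reasoning)
open import Relation.Nullary using (yes; no)
open import Relation.Unary using (Decidable)
open import Relation.Binary.Bundles using (DecTotalOrder)
open import Data.List.Extrema (DecTotalOrder.totalOrder ℚ.≤-decTotalOrder) using (v≤max⁺)

-- Lower bounds on the number of list entries with a property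

-- `skip` may pass over any entry, whether `P` holds there or not, so only a lower bound is recorded
-- and `P` need not be decidable.
data AtLeast {A : Set} (P : A → Set) : ℕ → List A → Set where
  []   : AtLeast P 0 []
  _∷_  : ∀ {m x xs} → P x → AtLeast P m xs → AtLeast P (suc m) (x ∷ xs)
  skip : ∀ {m x xs} → AtLeast P m xs → AtLeast P m (x ∷ xs)

module _ {A : Set} where

  recount : ∀ {P : A → Set} {m n xs} → m ≡ n → AtLeast P m xs → AtLeast P n xs
  recount refl ps = ps

  atLeast-map : ∀ {P Q : A → Set} {m xs} → (∀ {x} → P x → Q x) →
                AtLeast P m xs → AtLeast Q m xs
  atLeast-map f []       = []
  atLeast-map f (p ∷ ps) = f p ∷ atLeast-map f ps
  atLeast-map f (skip p) = skip (atLeast-map f p)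

  atLeast-0 : ∀ {P : A → Set} xs → AtLeast P 0 xs
  atLeast-0 []       = []
  atLeast-0 (x ∷ xs) = skip (atLeast-0 xs)

  atLeast-++⁺ : ∀ {P : A → Set} {m n xs ys} →
                AtLeast P m xs → AtLeast P n ys → AtLeast P (m + n) (xs ++ ys)
  atLeast-++⁺ []       qs = qs
  atLeast-++⁺ (p ∷ ps) qs = p ∷ atLeast-++⁺ ps qs
  atLeast-++⁺ (skip p) qs = skip (atLeast-++⁺ p qs)

  atLeast-++⁻ : ∀ {P : A → Set} {m} xs {ys} → AtLeast P m (xs ++ ys) →
                ∃[ a ] ∃[ b ] a + b ≡ m × AtLeast P a xs × AtLeast P b ys
  atLeast-++⁻ []       ps = 0 , _ , refl , [] , ps
  atLeast-++⁻ (x ∷ xs) (p ∷ ps) =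
    let a , b , eq , qs , rs = atLeast-++⁻ xs ps in suc a , b , cong suc eq , p ∷ qs , rs
  atLeast-++⁻ (x ∷ xs) (skip ps) =
    let a , b , eq , qs , rs = atLeast-++⁻ xs ps in a , b , eq , skip qs , rs

  atLeast-map⁺ : ∀ {B : Set} {P : A → Set} (f : B → A) {m xs} →
                 AtLeast (P ∘ f) m xs → AtLeast P m (map f xs)
  atLeast-map⁺ f []       = []
  atLeast-map⁺ f (p ∷ ps) = p ∷ atLeast-map⁺ f ps
  atLeast-map⁺ f (skip p) = skip (atLeast-map⁺ f p)

  atLeast-map⁻ : ∀ {B : Set} {P : A → Set} (f : B → A) {m} xs →
                 AtLeast P m (map f xs) → AtLeast (P ∘ f) m xs
  atLeast-map⁻ f []       []       = []
  atLeast-map⁻ f (x ∷ xs) (p ∷ ps) = p ∷ atLeast-map⁻ f xs ps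
  atLeast-map⁻ f (x ∷ xs) (skip p) = skip (atLeast-map⁻ f xs p)

  -- Sum rule: by disjointness no position is selected on both sides.
  atLeast-⊎ : ∀ {P Q : A → Set} {m n xs} → (∀ {x} → P x → Q x → ⊥) →
              AtLeast P m xs → AtLeast Q n xs → AtLeast (λ x → P x ⊎ Q x) (m + n) xs
  atLeast-⊎ disj []        []        = []
  atLeast-⊎ disj (p ∷ ps)  (q ∷ qs)  = ⊥-elim (disj p q)
  atLeast-⊎ disj (p ∷ ps)  (skip qs) = inj₁ p ∷ atLeast-⊎ disj ps qs
  atLeast-⊎ disj (skip {m} ps) (_∷_ {n} q qs) =
    recount (sym (+-suc m n)) (inj₂ q ∷ atLeast-⊎ disj ps qs)
  atLeast-⊎ disj (skip ps) (skip qs) = skip (atLeast-⊎ disj ps qs)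

  module _ {P : A → Set} (P? : Decidable P) where

    atLeast-length-filter : ∀ xs → AtLeast P (length (filter P? xs)) xs
    atLeast-length-filter []       = []
    atLeast-length-filter (x ∷ xs) with P? x
    ... | yes p = p ∷ atLeast-length-filter xs
    ... | no  _ = skip (atLeast-length-filter xs)

    atLeast⇒≤length-filter : ∀ {m xs} → AtLeast P m xs → m ≤ length (filter P? xs)
    atLeast⇒≤length-filter [] = z≤n
    atLeast⇒≤length-filter (_∷_ {x = x} p ps) with P? x
    ... | yes _ = s≤s (atLeast⇒≤length-filter ps)
    ... | no ¬p = ⊥-elim (¬p p)
    atLeast⇒≤length-filter (skip {x = x} ps) with P? x
    ... | yes _ = m≤n⇒m≤1+n (atLeast⇒≤length-filter ps)
    ... | no  _ = atLeast⇒≤length-filter ps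

-- Product rule: `take` and `drop` identify a subset of m + n leaves with a pair of subsets.
atLeast-subsets-+ : ∀ m {n a b} {P : Subset m → Set} {Q : Subset n → Set} →
  AtLeast P a (subsets m) → AtLeast Q b (subsets n) →
  AtLeast (λ L → P (take m L) × Q (drop m L)) (a * b) (subsets (m + n))
-- The only entry of `subsets 0` is the empty vector, so `a` is 0 or 1.
atLeast-subsets-+ zero {n} (skip []) qs = atLeast-0 (subsets n)
atLeast-subsets-+ zero {b = b} (p ∷ []) qs =
  recount (sym (+-identityʳ b)) (atLeast-map (p ,_) qs)
atLeast-subsets-+ (suc m) {b = b} ps qs
  with atLeast-++⁻ (map (inside ∷_) (subsets m)) ps
... | a₁ , a₂ , refl , ps₁ , ps₂ =
  recount (sym (*-distribʳ-+ b a₁ a₂))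
    (atLeast-++⁺
      (atLeast-map⁺ (inside ∷_)
        (atLeast-subsets-+ m (atLeast-map⁻ (inside ∷_) (subsets m) ps₁) qs))
      (atLeast-map⁺ (outside ∷_)
        (atLeast-subsets-+ m (atLeast-map⁻ (outside ∷_) (subsets m) ps₂) qs)))

-- Induced trees by recursion on the host tree

leaf : Tree
leaf = node []

-- `atMRCA` is left out: `suppress` already erases a chain of outdegree-1 vertices at the root. This
-- makes recursion on the host tree possible.
ind : (T : Tree) → Subset ∣ T ∣ → Maybe Tree
ind T L = Maybe.map suppress (prune T L)

ind* : (ts : List Tree) → Subset ∣ ts ∣* → List Tree
ind* ts L = suppress* (prune* ts L)

suppress-atMRCA : ∀ t → suppress (atMRCA t) ≡ suppress t
suppress-atMRCA (node [])          = refl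
suppress-atMRCA (node (t ∷ []))    = suppress-atMRCA t
suppress-atMRCA (node (_ ∷ _ ∷ _)) = refl

induced≡ind : ∀ T L → induced T L ≡ ind T L
induced≡ind T L = Maybe.map-cong suppress-atMRCA (prune T L)

-- What happens at a vertex once its children are processed: it disappears with no surviving child,
-- is suppressed with one, and stays otherwise.
collapse : List Tree → Maybe Tree
collapse []              = nothing
collapse (t ∷ [])        = just t
collapse ts@(_ ∷ _ ∷ _)  = just (node ts)

ind-node : ∀ t ts L → ind (node (t ∷ ts)) L ≡ collapse (ind* (t ∷ ts) L)
ind-node t ts L with prune* (t ∷ ts) L
... | []        = refl
... | _ ∷ []    = refl
... | _ ∷ _ ∷ _ = refl

ind*-∷ : ∀ t ts L →
         ind* (t ∷ ts) L ≡ fromMaybe (ind t (take ∣ t ∣ L)) ++ ind* ts (drop ∣ t ∣ L)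
ind*-∷ t ts L with prune t (take ∣ t ∣ L)
... | nothing = refl
... | just _  = refl

-- For the subtrees surviving in a forest, this means that all chosen leaves lie in one tree of the
-- forest.
Single : (Tree → Set) → List Tree → Set
Single P us = ∃[ u ] us ≡ u ∷ [] × P u

Inducing : (Tree → Set) → (T : Tree) → Subset ∣ T ∣ → Set
Inducing P T L = MaybeAny.Any P (ind T L)

Inducing* : (Tree → Set) → (ts : List Tree) → Subset ∣ ts ∣* → Set
Inducing* P ts L = Single P (ind* ts L)

mutual
  -- The empty set of leaves, with which a choice in one branch is extended over the other branches.
  atLeast-empty : ∀ t → AtLeast (λ L → ind t L ≡ nothing) 1 (subsets ∣ t ∣)
  atLeast-empty (node [])       = skip (refl ∷ [])
  atLeast-empty (node (t ∷ ts)) =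
    atLeast-map (λ {L} e → trans (ind-node t ts L) (cong collapse e)) (atLeast-empty* (t ∷ ts))

  atLeast-empty* : ∀ ts → AtLeast (λ L → ind* ts L ≡ []) 1 (subsets ∣ ts ∣*)
  atLeast-empty* []       = refl ∷ []
  atLeast-empty* (t ∷ ts) =
    atLeast-map (λ {L} (e , e*) → trans (ind*-∷ t ts L) (cong₂ _++_ (cong fromMaybe e) e*))
      (atLeast-subsets-+ ∣ t ∣ (atLeast-empty t) (atLeast-empty* ts))

inducing-node : ∀ {P m} t ts → AtLeast (Inducing* P (t ∷ ts)) m (subsets ∣ t ∷ ts ∣*) →
                AtLeast (Inducing P (node (t ∷ ts))) m (subsets ∣ node (t ∷ ts) ∣)
inducing-node {P} t ts =
  atLeast-map λ {L} (u , e , p) →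
    subst (MaybeAny.Any P) (sym (trans (ind-node t ts L) (cong collapse e))) (just p)

-- A choice in the head is paired with the empty choice in the tail, and vice versa. The head
-- induces a tree in the first case only, so the two families are disjoint and the counts m * 1 and
-- 1 * n add up.
inducing-∷ : ∀ {P m n} t ts →
  AtLeast (Inducing P t) m (subsets ∣ t ∣) → AtLeast (Inducing* P ts) n (subsets ∣ ts ∣*) →
  AtLeast (Inducing* P (t ∷ ts)) (m + n) (subsets ∣ t ∷ ts ∣*)
inducing-∷ {P} {m} {n} t ts ps qs =
  recount (cong₂ _+_ (*-identityʳ m) (+-identityʳ n))
    (atLeast-map (λ {L} → [ inHead L , inTail L ]′)
      (atLeast-⊎ (λ (p , _) (e , _) → nonempty p e)
        (atLeast-subsets-+ ∣ t ∣ ps (atLeast-empty* ts))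
        (atLeast-subsets-+ ∣ t ∣ (atLeast-empty t) qs)))
  where
  nonempty : ∀ {u} → MaybeAny.Any P u → u ≡ nothing → ⊥
  nonempty (just _) ()

  fromMaybe-any : ∀ {u} → MaybeAny.Any P u → Single P (fromMaybe u ++ [])
  fromMaybe-any (just p) = _ , refl , p

  inHead : ∀ L → Inducing P t (take ∣ t ∣ L) × ind* ts (drop ∣ t ∣ L) ≡ [] →
           Inducing* P (t ∷ ts) L
  inHead L (p , e) = subst (Single P)
    (sym (trans (ind*-∷ t ts L) (cong (fromMaybe (ind t (take ∣ t ∣ L)) ++_) e)))
    (fromMaybe-any p)

  inTail : ∀ L → ind t (take ∣ t ∣ L) ≡ nothing × Inducing* P ts (drop ∣ t ∣ L) →
           Inducing* P (t ∷ ts) L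
  inTail L (e , p) = subst (Single P)
    (sym (trans (ind*-∷ t ts L) (cong (λ u → fromMaybe u ++ ind* ts (drop ∣ t ∣ L)) e))) p

mutual
  -- The sets counted are the singletons.
  atLeast-leaf : ∀ t → AtLeast (Inducing (_≡ leaf) t) ∣ t ∣ (subsets ∣ t ∣)
  atLeast-leaf (node [])       = just refl ∷ skip []
  atLeast-leaf (node (t ∷ ts)) = inducing-node t ts (atLeast-leaf* (t ∷ ts))

  atLeast-leaf* : ∀ ts → AtLeast (Inducing* (_≡ leaf) ts) ∣ ts ∣* (subsets ∣ ts ∣*)
  atLeast-leaf* []       = skip []
  atLeast-leaf* (t ∷ ts) = inducing-∷ t ts (atLeast-leaf t) (atLeast-leaf* ts)

-- Substitution of a tree for every leaf

infixr 7 _⊗_ _⊗*_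

mutual
  _⊗_ : Tree → Tree → Tree
  node []       ⊗ T = T
  node (u ∷ us) ⊗ T = node ((u ∷ us) ⊗* T)

  _⊗*_ : List Tree → Tree → List Tree
  []       ⊗* T = []
  (u ∷ us) ⊗* T = u ⊗ T ∷ us ⊗* T

mutual
  ∣⊗∣ : ∀ U T → ∣ U ⊗ T ∣ ≡ ∣ U ∣ * ∣ T ∣
  ∣⊗∣ (node [])       T = sym (*-identityˡ ∣ T ∣)
  ∣⊗∣ (node (u ∷ us)) T = ∣⊗*∣ (u ∷ us) T

  ∣⊗*∣ : ∀ us T → ∣ us ⊗* T ∣* ≡ ∣ us ∣* * ∣ T ∣
  ∣⊗*∣ []       T = refl
  ∣⊗*∣ (u ∷ us) T =
    trans (cong₂ _+_ (∣⊗∣ u T) (∣⊗*∣ us T)) (sym (*-distribʳ-+ (∣ T ∣) (∣ u ∣) (∣ us ∣*)))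

length-⊗* : ∀ us T → length (us ⊗* T) ≡ length us
length-⊗* []       T = refl
length-⊗* (u ∷ us) T = cong suc (length-⊗* us T)

mutual
  ⊗-topological : ∀ {U T} → Topological U → Topological T → Topological (U ⊗ T)
  ⊗-topological {node []}           _           q = q
  ⊗-topological {node (u ∷ us)} {T} (node l ps) q =
    node (l ∘ trans (sym (length-⊗* (u ∷ us) T))) (⊗*-topological ps q)

  ⊗*-topological : ∀ {us T} → All Topological us → Topological T → All Topological (us ⊗* T)
  ⊗*-topological []       q = []
  ⊗*-topological (p ∷ ps) q = ⊗-topological p q ∷ ⊗*-topological ps q

module _ {P : Tree → Set} {m T} (h : AtLeast (Inducing P T) m (subsets ∣ T ∣)) where
  mutual
    -- For a choice inside a single copy of `T`, the path from the root down to that copy is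
    -- suppressed, so the induced tree is the one induced in `T`.
    withinCopy : ∀ U → AtLeast (Inducing P (U ⊗ T)) (∣ U ∣ * m) (subsets ∣ U ⊗ T ∣)
    withinCopy (node [])       = recount (sym (*-identityˡ m)) h
    withinCopy (node (u ∷ us)) = inducing-node (u ⊗ T) (us ⊗* T) (withinCopy* (u ∷ us))

    withinCopy* : ∀ us → AtLeast (Inducing* P (us ⊗* T)) (∣ us ∣* * m) (subsets ∣ us ⊗* T ∣*)
    withinCopy* []       = skip []
    withinCopy* (u ∷ us) =
      recount (sym (*-distribʳ-+ m (∣ u ∣) (∣ us ∣*)))
        (inducing-∷ (u ⊗ T) (us ⊗* T) (withinCopy u) (withinCopy* us))

collapse-≢1 : ∀ t ts → length (t ∷ ts) ≢ 1 → collapse (t ∷ ts) ≡ just (node (t ∷ ts))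
collapse-≢1 t []       ≢1 = ⊥-elim (≢1 refl)
collapse-≢1 t (_ ∷ _)  _  = refl

any-≡⇒≡just : ∀ {U : Tree} {u} → MaybeAny.Any (_≡ U) u → u ≡ just U
any-≡⇒≡just (just refl) = refl

mutual
  -- One leaf is chosen in each copy of `T`. Every vertex of `U` keeps all its children, and none is
  -- suppressed because `U` is topological; hence `U` comes back with an equality and not merely up
  -- to `_≅_`.
  transversal : ∀ {U} T → Topological U →
    AtLeast (λ L → ind (U ⊗ T) L ≡ just U) (∣ T ∣ ^ ∣ U ∣) (subsets ∣ U ⊗ T ∣)
  transversal {node []} T _ =
    recount (sym (*-identityʳ ∣ T ∣))
      (atLeast-map any-≡⇒≡just (atLeast-leaf T))
  transversal {node (u ∷ us)} T (node ≢1 ps) =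
    atLeast-map (λ {L} e → trans (ind-node (u ⊗ T) (us ⊗* T) L)
                                 (trans (cong collapse e) (collapse-≢1 u us ≢1)))
      (transversal* T ps)

  transversal* : ∀ {us} T → All Topological us →
    AtLeast (λ L → ind* (us ⊗* T) L ≡ us) (∣ T ∣ ^ ∣ us ∣*) (subsets ∣ us ⊗* T ∣*)
  transversal* {[]}     T []       = refl ∷ []
  transversal* {u ∷ us} T (p ∷ ps) =
    recount (sym (^-distribˡ-+-* (∣ T ∣) (∣ u ∣) (∣ us ∣*)))
      (atLeast-map (λ {L} (e , e*) → trans (ind*-∷ (u ⊗ T) (us ⊗* T) L)
                                           (cong₂ _++_ (cong fromMaybe e) e*))
        (atLeast-subsets-+ ∣ u ⊗ T ∣ (transversal T p) (transversal* T ps)))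

-- The transversal choices and the choices within one copy both induce `S`. They are told apart at
-- the root: all children of the root of `S` survive in the former, which are not one in number, and
-- exactly one child survives in the latter.
c-⊗ : ∀ S T → Topological S → 2 ≤ ∣ S ∣ → ∣ T ∣ ^ ∣ S ∣ + ∣ S ∣ * c S T ≤ c S (S ⊗ T)
c-⊗ (node []) T _ (s≤s ())
c-⊗ S@(node (s ∷ ss)) T (node ≢1 ps) _ =
  atLeast⇒≤length-filter (induces? S (S ⊗ T))
    (atLeast-map (λ {L} → [ whole L , inner L ]′)
      (atLeast-⊎ disjoint (transversal* T ps)
        (withinCopy*
          (atLeast-map (λ {L} → subst (MaybeAny.Any (_≅ S)) (induced≡ind T L))
            (atLeast-length-filter (induces? S T) (subsets ∣ T ∣)))
          (s ∷ ss))))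
  where
  disjoint : ∀ {us : List Tree} → us ≡ s ∷ ss → Single (_≅ S) us → ⊥
  disjoint refl (_ , e , _) = ≢1 (cong length e)

  induces : ∀ L {us u} → ind* ((s ∷ ss) ⊗* T) L ≡ us → collapse us ≡ just u → u ≅ S →
            Induces S (S ⊗ T) L
  induces L e e′ p = subst (MaybeAny.Any (_≅ S))
    (sym (trans (induced≡ind (S ⊗ T) L)
      (trans (ind-node (s ⊗ T) (ss ⊗* T) L) (trans (cong collapse e) e′))))
    (just p)

  whole : ∀ L → ind* ((s ∷ ss) ⊗* T) L ≡ s ∷ ss → Induces S (S ⊗ T) L
  whole L e = induces L e (collapse-≢1 s ss ≢1) ≅-refl

  inner : ∀ L → Inducing* (_≅ S) ((s ∷ ss) ⊗* T) L → Induces S (S ⊗ T) L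
  inner L (_ , e , p) = induces L e refl p

-- The iterated trees

infix 8 _⊗^_

_⊗^_ : Tree → ℕ → Tree
S ⊗^ zero  = leaf
S ⊗^ suc h = S ⊗ S ⊗^ h

∣⊗^∣ : ∀ S h → ∣ S ⊗^ h ∣ ≡ ∣ S ∣ ^ h
∣⊗^∣ S zero    = refl
∣⊗^∣ S (suc h) = trans (∣⊗∣ S (S ⊗^ h)) (cong (∣ S ∣ *_) (∣⊗^∣ S h))

⊗^-topological : ∀ {S} → Topological S → ∀ h → Topological (S ⊗^ h)
⊗^-topological p zero    = node (λ ()) []
⊗^-topological p (suc h) = ⊗-topological p (⊗^-topological p h)

^-distribʳ-* : ∀ m n o → (m * n) ^ o ≡ m ^ o * n ^ o
^-distribʳ-* m n zero    = refl
^-distribʳ-* m n (suc o) =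
  trans (cong (m * n *_) (^-distribʳ-* m n o)) ([m*n]*[o*p]≡[m*o]*[n*p] m n (m ^ o) (n ^ o))

step-split : ∀ k D z → k * suc D * z ≡ k * (D * z) + k * z
step-split = solve-∀

step-merge : ∀ k D z x n →
  k * (D * z) + k * (k * (D * x) + n) ≡ k * (D * (z + k * x)) + k * n
step-merge = solve-∀

-- Here D stands for kᵏ⁻¹ - 1, n for the number of leaves, and x and y for the counts at two
-- successive heights. One of the k * (D + 1) copies of nᵏ in each kᵏ nᵏ, taken k times, is traded
-- for the induction hypothesis.
c-⊗^-step : ∀ k D n x y → k ^ k ≡ k * suc D → n ^ k ≤ k * (D * x) + n →
                    n ^ k + k * x ≤ y → (k * n) ^ k ≤ k * (D * y) + k * n
c-⊗^-step k D n x y k^k≡ ih le = begin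
  (k * n) ^ k                              ≡⟨ ^-distribʳ-* k n k ⟩
  k ^ k * n ^ k                            ≡⟨ cong (_* n ^ k) k^k≡ ⟩
  k * suc D * n ^ k                        ≡⟨ step-split k D (n ^ k) ⟩
  k * (D * n ^ k) + k * n ^ k              ≤⟨ +-monoʳ-≤ _ (*-monoʳ-≤ k ih) ⟩
  k * (D * n ^ k) + k * (k * (D * x) + n)  ≡⟨ step-merge k D (n ^ k) x n ⟩
  k * (D * (n ^ k + k * x)) + k * n        ≤⟨ +-monoˡ-≤ (k * n) (*-monoʳ-≤ k (*-monoʳ-≤ D le)) ⟩
  k * (D * y) + k * n                      ∎
  where open ≤-Reasoning

-- This is nᵏ - n ≤ (kᵏ - k) c(S, Tₕ) with n moved to the right, which avoids a truncated
-- subtraction.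
c-⊗^ : ∀ {S j} → Topological S → ∣ S ∣ ≡ suc j → 2 ≤ ∣ S ∣ → ∀ h →
  let k = suc j in (k ^ h) ^ k ≤ k * ((k ^ j ∸ 1) * c S (S ⊗^ h)) + k ^ h
c-⊗^ {j = j} p eq 2≤S zero = ≤-trans (≤-reflexive (^-zeroˡ (suc j))) (m≤n+m 1 _)
c-⊗^ {S} {j} p eq 2≤S (suc h) =
  c-⊗^-step k (k ^ j ∸ 1) (k ^ h) (c S (S ⊗^ h)) (c S (S ⊗^ suc h))
    -- Since kʲ is positive, adding 1 to `k ^ j ∸ 1` restores it.
    (cong (k *_) (sym (m+[n∸m]≡n (m^n>0 k j))))
    (c-⊗^ p eq 2≤S h)
    (subst (_≤ c S (S ⊗^ suc h))
      (cong₂ (λ a b → a ^ b + b * c S (S ⊗^ h)) (trans (∣⊗^∣ S h) (cong (_^ h) eq)) eq)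
      (c-⊗ S (S ⊗^ h) p 2≤S))
  where
  k = suc j

-- Binomial coefficients

nCk*k![n∸k]!≡n! : ∀ {n k} → k ≤ n → (n C k) * (k ! * (n ∸ k) !) ≡ n !
nCk*k![n∸k]!≡n! {n} {k} k≤n =
  trans (cong (_* (k ! * (n ∸ k) !)) (nCk≡n!/k![n-k]! k≤n)) (m/n*n≡m (k![n∸k]!∣n! k≤n))
  where instance _ = k !* (n ∸ k) !≢0

nCk≢0 : ∀ {n k} → k ≤ n → n C k ≢ 0
nCk≢0 {n} {k} k≤n e =
  ≢-nonZero⁻¹ (n !) {{n !≢0}}
    (trans (sym (nCk*k![n∸k]!≡n! k≤n)) (cong (_* (k ! * (n ∸ k) !)) e))

-- `k ! * (n C k)` is the falling factorial n (n - 1) ... (n - k + 1); its first factor is split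
-- off. Both sides vanish for k > n; otherwise (n - k)! is cancelled.
k!*nCk-suc : ∀ n k → suc k ! * (suc n C suc k) ≡ suc n * (k ! * (n C k))
k!*nCk-suc n k with k ≤? n
... | no k≰n = begin
  suc k ! * (suc n C suc k) ≡⟨ cong (suc k ! *_) (k>n⇒nCk≡0 (s≤s (≰⇒> k≰n))) ⟩
  suc k ! * 0               ≡⟨ *-zeroʳ (suc k !) ⟩
  0                         ≡⟨ *-zeroʳ (suc n) ⟨
  suc n * 0                 ≡⟨ cong (suc n *_) (*-zeroʳ (k !)) ⟨
  suc n * (k ! * 0)         ≡⟨ cong (λ m → suc n * (k ! * m)) (k>n⇒nCk≡0 (≰⇒> k≰n)) ⟨
  suc n * (k ! * (n C k))   ∎
  where open ≡-Reasoning
... | yes k≤n = *-cancelʳ-≡ _ _ ((n ∸ k) !) (begin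
  suc k ! * (suc n C suc k) * (n ∸ k) !    ≡⟨ shuffle (suc k !) (suc n C suc k) ((n ∸ k) !) ⟩
  (suc n C suc k) * (suc k ! * (n ∸ k) !)  ≡⟨ nCk*k![n∸k]!≡n! (s≤s k≤n) ⟩
  suc n * n !                              ≡⟨ cong (suc n *_) (nCk*k![n∸k]!≡n! k≤n) ⟨
  suc n * ((n C k) * (k ! * (n ∸ k) !))    ≡⟨ cong (suc n *_) (shuffle (k !) (n C k) ((n ∸ k) !)) ⟨
  suc n * (k ! * (n C k) * (n ∸ k) !)      ≡⟨ *-assoc (suc n) (k ! * (n C k)) ((n ∸ k) !) ⟨
  suc n * (k ! * (n C k)) * (n ∸ k) !      ∎)
  where
  open ≡-Reasoning
  instance _ = (n ∸ k) !≢0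
  shuffle : ∀ a b d → a * b * d ≡ b * (a * d)
  shuffle = solve-∀

k!*nCk≤n^k : ∀ n k → k ! * (n C k) ≤ n ^ k
k!*nCk≤n^k n       zero    = ≤-refl
k!*nCk≤n^k zero    (suc k) = ≤-reflexive (*-zeroʳ (suc k !))
k!*nCk≤n^k (suc n) (suc k) = begin
  suc k ! * (suc n C suc k)  ≡⟨ k!*nCk-suc n k ⟩
  suc n * (k ! * (n C k))    ≤⟨ *-monoʳ-≤ (suc n) (k!*nCk≤n^k n k) ⟩
  suc n * n ^ k              ≤⟨ *-monoʳ-≤ (suc n) (^-monoˡ-≤ k (n≤1+n n)) ⟩
  suc n * suc n ^ k          ∎
  where open ≤-Reasoning

-- After the first factor n is split off, the rest is at most (n - 1)ᵏ⁻¹, which is strictly below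
-- nᵏ⁻¹ as k ≥ 2. The gap of at least 1, times n, pays for the summand n.
k!*nCk+n≤n^k : ∀ n {k} → 2 ≤ k → k ! * (n C k) + n ≤ n ^ k
k!*nCk+n≤n^k zero    {suc k} _ = ≤-reflexive (trans (+-identityʳ _) (*-zeroʳ (suc k !)))
k!*nCk+n≤n^k (suc n) {suc zero} (s≤s ())
k!*nCk+n≤n^k (suc n) {suc k@(suc _)} _ = begin
  suc k ! * (suc n C suc k) + suc n   ≡⟨ cong (_+ suc n) (k!*nCk-suc n k) ⟩
  suc n * (k ! * (n C k)) + suc n     ≡⟨ +-comm _ (suc n) ⟩
  suc n + suc n * (k ! * (n C k))     ≡⟨ *-suc (suc n) _ ⟨
  suc n * suc (k ! * (n C k))         ≤⟨ *-monoʳ-≤ (suc n) (s≤s (k!*nCk≤n^k n k)) ⟩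
  suc n * suc (n ^ k)                 ≤⟨ *-monoʳ-≤ (suc n) (^-monoˡ-< k (n<1+n n)) ⟩
  suc n * suc n ^ k                   ∎
  where open ≤-Reasoning

-- Densities and the limit superior

÷-mono-≤ : ∀ {a b x y} → y ≢ 0 → a * y ≤ b * x → a ÷ x ℚ.≤ b ÷ y
÷-mono-≤ {y = zero} y≢0 _ = ⊥-elim (y≢0 refl)
-- The left side is 0 by the convention on `_÷_`.
÷-mono-≤ {b = b} {zero} {suc y} _ _ =
  ℚ.nonNegative⁻¹ _ {{ℚ.normalize-nonNeg b (suc y)}}
÷-mono-≤ {a} {b} {suc x} {suc y} _ le =
  ℚ.toℚᵘ-cancel-≤ (ℚᵘ.≤-respˡ-≃ (ℚᵘ.≃-sym (ℚ.toℚᵘ-fromℚᵘ (ℚᵘ.mkℚᵘ (ℤ.+ a) x)))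
    (ℚᵘ.≤-respʳ-≃ (ℚᵘ.≃-sym (ℚ.toℚᵘ-fromℚᵘ (ℚᵘ.mkℚᵘ (ℤ.+ b) y)))
      (ℚᵘ.*≤* (subst₂ ℤ._≤_ (ℤ.pos-* a (suc y)) (ℤ.pos-* b (suc x)) (ℤ.+≤+ le)))))

-- Used to find iterated trees with arbitrarily many leaves.
n≤m^n : ∀ {m} → 2 ≤ m → ∀ n → n ≤ m ^ n
n≤m^n 2≤m zero    = z≤n
n≤m^n {m} 2≤m (suc n) = begin
  suc n          ≤⟨ s≤s (n≤m^n 2≤m n) ⟩
  1 + m ^ n      ≤⟨ +-monoˡ-≤ (m ^ n) (m^n>0 m n) ⟩
  m ^ n + m ^ n  ≡⟨ cong (m ^ n +_) (+-identityʳ (m ^ n)) ⟨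
  2 * m ^ n      ≤⟨ *-monoˡ-≤ (m ^ n) 2≤m ⟩
  m * m ^ n      ∎
  where
  open ≤-Reasoning
  instance _ = >-nonZero (≤-trans (s≤s z≤n) 2≤m)

-- The bounds on `c` and on the binomial coefficient carry the same term n, which cancels and leaves
-- an exact inequality. Height at least 1 gives |S| ≤ n, so the denominator of the density is
-- nonzero.
γ-⊗^ : ∀ {S} → Topological S → 2 ≤ ∣ S ∣ → ∀ h →
       ((∣ S ∣ ∸ 1) !) ÷ (∣ S ∣ ^ (∣ S ∣ ∸ 1) ∸ 1) ℚ.≤ γ S (S ⊗^ suc h)
γ-⊗^ {S} p 2≤S h with ∣ S ∣ in eq
... | suc j = ÷-mono-≤
  (subst (λ m → m C k ≢ 0) (sym size) (nCk≢0 (m≤m*n k (k ^ h) {{m^n≢0 k h}})))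
  -- The factor k turns (k - 1)! into k! and kᵏ⁻¹ - 1 into kᵏ - k.
  (*-cancelˡ-≤ k (begin
    k * (j ! * (∣ S ⊗^ suc h ∣ C k)) ≡⟨ cong (λ m → k * (j ! * (m C k))) size ⟩
    k * (j ! * (n C k))              ≡⟨ *-assoc k (j !) (n C k) ⟨
    k ! * (n C k)                    ≤⟨ +-cancelʳ-≤ n _ _ (≤-trans (k!*nCk+n≤n^k n 2≤S) lower) ⟩
    k * ((k ^ j ∸ 1) * x)            ≡⟨ cong (k *_) (*-comm (k ^ j ∸ 1) x) ⟩
    k * (x * (k ^ j ∸ 1))            ∎))
  where
  open ≤-Reasoning
  k = suc j
  n = k ^ suc h
  x = c S (S ⊗^ suc h)

  lower : n ^ k ≤ k * ((k ^ j ∸ 1) * x) + n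
  lower = c-⊗^ p eq (subst (2 ≤_) (sym eq) 2≤S) (suc h)

  size : ∣ S ⊗^ suc h ∣ ≡ n
  size = trans (∣⊗^∣ S (suc h)) (cong (_^ suc h) eq)

proposition10 : (S : Tree) → Topological S → 2 ≤ ∣ S ∣ →
    ι (((∣ S ∣ ∸ 1) !) ÷ (∣ S ∣ ^ (∣ S ∣ ∸ 1) ∸ 1)) ≤ℝ J S
proposition10 S p 2≤S q q<b with ℚ.<-dense q<b
-- The point r between q and the bound supplies the uniform margin that `inf` demands.
... | r , q<r , r<b = r , q<r , λ N →
  let T = S ⊗^ suc N in
  -- Height N + 1 suffices, since N ≤ N + 1 ≤ kᴺ⁺¹.
  (∣ T ∣ , ≤-trans (n≤1+n N) (≤-trans (n≤m^n 2≤S (suc N))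
      (≤-reflexive (sym (∣⊗^∣ S (suc N))))))
  , ℚ.<-≤-trans r<b (ℚ.≤-trans (γ-⊗^ p 2≤S N)
      -- `T` is topological and hence listed in `trees`, so its density enters the maximum.
      (v≤max⁺ ℚ.0ℚ _ (inj₂ (lose (∈-map⁺ (γ S) (∈-trees⁺ (⊗^-topological p (suc N))))
                                  ℚ.≤-refl))))
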